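{- Let $\mathcal{Q}$ be a small quantaloid. For any $\mathcal{Q}$-distributor $\phi:\mathbb{A}\nrightarrow\mathbb{B}$ between $\mathcal{Q}$-categories, a separated complete $\mathcal{Q}$-category $\mathbb{X}$ is isomorphic to $\mathsf{M}\phi$ if, and only if, there exist a $\bigvee$-dense type-preserving map $F:\mathbb{A}_0\times_{\mathrm{dom}}\mathcal{Q}_1\to\mathbb{X}_0$ and a $\bigwedge$-dense type-preserving map $G:\mathbb{B}_0\times_{\mathrm{cod}}\mathcal{Q}_1\to\mathbb{X}_0$ such that $$v\searrow(\phi(a,b)\swarrow u)=\mathbb{X}(F(a,u),G(b,v))$$ for all $(a,u)\in\mathbb{A}_0\times_{\mathrm{dom}}\mathcal{Q}_1$, $(b,v)\in\mathbb{B}_0\times_{\mathrm{cod}}\mathcal{Q}_1$.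
   Context: A quantaloid $\mathcal{Q}$ is a category whose hom-sets are complete lattices and whose composition $\circ$ preserves joins in each variable; small means it has a set $\mathcal{Q}_0$ of objects and a set $\mathcal{Q}_1$ of arrows; $1_q$ denotes identities. For $u:p\to q$, $v:q\to r$, $w:p\to r$, the implications $w\swarrow u:q\to r$ and $v\searrow w:p\to q$ are determined by $v\circ u\leq w\iff v\leq w\swarrow u\iff u\leq v\searrow w$. A $\mathcal{Q}$-typed set is a set $A$ with a map $|\cdot|:A\to\mathcal{Q}_0$; maps preserving types are type-preserving. A $\mathcal{Q}$-category $\mathbb{A}$ is a $\mathcal{Q}$-typed set $\mathbb{A}_0$ with arrows $\mathbb{A}(x,y)\in\mathcal{Q}(|x|,|y|)$ such that $1_{|x|}\leq\mathbb{A}(x,x)$ and $\mathbb{A}(y,z)\circ\mathbb{A}(x,y)\leq\mathbb{A}(x,z)$. A $\mathcal{Q}$-subcategory is a subset of objects with the same hom-arrows. The underlying preorder: $x\leq y$ iff $|x|=|y|$ and $1_{|x|}\leq\mathbb{A}(x,y)$; $x\cong y$ means $x\leq y$ and $y\leq x$; $\mathbb{A}$ is separated if $x\cong y$ implies $x=y$. A $\mathcal{Q}$-functor $F:\mathbb{A}\to\mathbb{B}$ is a type-preserving map $\mathbb{A}_0\to\mathbb{B}_0$ with $\mathbb{A}(x,x')\leq\mathbb{B}(Fx,Fx')$; an isomorphism is a $\mathcal{Q}$-functor with a two-sided inverse $\mathcal{Q}$-functor. A $\mathcal{Q}$-distributor $\phi:\mathbb{A}\nrightarrow\mathbb{B}$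 is a family of arrows $\phi(x,y):|x|\to|y|$ with $\mathbb{B}(y,y')\circ\phi(x,y)\circ\mathbb{A}(x',x)\leq\phi(x',y')$. For $\phi:\mathbb{A}\nrightarrow\mathbb{B}$, $\psi:\mathbb{B}\nrightarrow\mathbb{C}$, $\xi:\mathbb{A}\nrightarrow\mathbb{C}$: $(\xi\swarrow\phi)(y,z)=\bigwedge_{x}\xi(x,z)\swarrow\phi(x,y)$, $(\psi\searrow\xi)(x,y)=\bigwedge_{z}\psi(y,z)\searrow\xi(x,z)$. $\{q\}$ is the $\mathcal{Q}$-category with one object of type $q$ and hom-arrow $1_q$. $\mathsf{P}\mathbb{A}$ is the $\mathcal{Q}$-category of presheaves $\mu:\mathbb{A}\nrightarrow\{q\}$ (of type $q$) with $\mathsf{P}\mathbb{A}(\mu,\mu')=\mu'\swarrow\mu$; $\mathsf{P}^\dagger\mathbb{A}$ is the $\mathcal{Q}$-category of copresheaves $\lambda:\{q\}\nrightarrow\mathbb{A}$ (of type $q$) with $\mathsf{P}^\dagger\mathbb{A}(\lambda,\lambda')=\lambda'\searrow\lambda$. $\mathbb{A}$ is complete if every $\mu\in\mathsf{P}\mathbb{A}$ has a supremum, i.e. an object $\sup\mu$ of type $|\mu|$ with $\mathbb{A}(\sup\mu,-)=\mathbb{A}\swarrow\mu$. For $\phi:\mathbb{A}\nrightarrow\mathbb{B}$: $\phi_\uparrow:\mathsf{P}\mathbb{A}\to\mathsf{P}^\dagger\mathbb{B}$, $\phi_\uparrow\mu=\phi\swarrow\mu$, and $\phi^\downarrow:\mathsf{P}^\dagger\mathbb{B}\to\mathsf{P}\mathbb{A}$,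 $\phi^\downarrow\lambda=\lambda\searrow\phi$; $\mathsf{M}\phi$ is the $\mathcal{Q}$-subcategory of $\mathsf{P}\mathbb{A}$ of all $\mu$ with $\phi^\downarrow\phi_\uparrow\mu=\mu$. $\mathbb{A}_0\times_{\mathrm{dom}}\mathcal{Q}_1$ is the $\mathcal{Q}$-typed set of pairs $(a,u)$ with $a\in\mathbb{A}_0$ and $u$ a $\mathcal{Q}$-arrow with domain $|a|$, with type $|(a,u)|=\mathrm{cod}\,u$. $\mathbb{B}_0\times_{\mathrm{cod}}\mathcal{Q}_1$ is the $\mathcal{Q}$-typed set of pairs $(b,v)$ with $b\in\mathbb{B}_0$ and $v$ a $\mathcal{Q}$-arrow with codomain $|b|$, with type $|(b,v)|=\mathrm{dom}\,v$. A type-preserving map $F:A\to\mathbb{X}_0$ from a $\mathcal{Q}$-typed set is $\bigvee$-dense (resp. $\bigwedge$-dense) if for every $y\in\mathbb{X}_0$ there is a family $\{x_i\}_{i\in I}\subseteq A$ with $y\cong\bigvee_{i\in I}Fx_i$ (resp. $y\cong\bigwedge_{i\in I}Fx_i$) in the underlying preorder of $\mathbb{X}$; here objects of different types are incomparable, and joins and meets (including those of empty families) are taken among objects of the type of $y$. -}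

module Defs where

open import Level using (Level; Lift; lift; suc)
open import Data.Bool.Base using (Bool; true; false)
open import Data.Product using (Σ; ∃; Σ-syntax; _×_; _,_; proj₁; proj₂)
open import Function.Base using (_∘′_)
open import Function.Bundles using (_⇔_; mk⇔; module Equivalence)
open import Relation.Binary.Bundles using (Setoid; Poset)
open import Relation.Binary.PropositionalEquality using (_≡_; refl)
import Relation.Binary.PropositionalEquality.Properties as ≡

-- One universe level ℓ plays the role of "sets": carriers, orders and the
-- index types of families all live in Set ℓ, so implications and the meets
-- over objects or presheaves below are again indexed by small types.
-- Equality on carriers is setoid equality throughout.

record CompleteLattice (ℓ : Level) : Set (suc ℓ) where
  field
    poset : Poset ℓ ℓ ℓ
  open Poset poset public
  field
    ⋁       : {I : Set ℓ} → (I → Carrier) → Carrier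
    ⋁-upper : {I : Set ℓ} (f : I → Carrier) (i : I) → f i ≤ ⋁ f
    ⋁-least : {I : Set ℓ} (f : I → Carrier) (x : Carrier) → (∀ i → f i ≤ x) → ⋁ f ≤ x
    ⋀          : {I : Set ℓ} → (I → Carrier) → Carrier
    ⋀-lower    : {I : Set ℓ} (f : I → Carrier) (i : I) → ⋀ f ≤ f i
    ⋀-greatest : {I : Set ℓ} (f : I → Carrier) (x : Carrier) → (∀ i → x ≤ f i) → x ≤ ⋀ f

record Quantaloid (ℓ : Level) : Set (suc ℓ) where
  infix  4 _≤_ _≈_
  infixr 9 _∘_
  field
    Q₀  : Set ℓ
    Hom : Q₀ → Q₀ → CompleteLattice ℓ

  Arr : Q₀ → Q₀ → Set ℓ
  Arr p q = CompleteLattice.Carrier (Hom p q)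

  _≤_ : {p q : Q₀} → Arr p q → Arr p q → Set ℓ
  _≤_ {p} {q} = CompleteLattice._≤_ (Hom p q)

  _≈_ : {p q : Q₀} → Arr p q → Arr p q → Set ℓ
  _≈_ {p} {q} = CompleteLattice._≈_ (Hom p q)

  ⋁ : {p q : Q₀} {I : Set ℓ} → (I → Arr p q) → Arr p q
  ⋁ {p} {q} = CompleteLattice.⋁ (Hom p q)

  ⋀ : {p q : Q₀} {I : Set ℓ} → (I → Arr p q) → Arr p q
  ⋀ {p} {q} = CompleteLattice.⋀ (Hom p q)

  field
    1ₐ  : (q : Q₀) → Arr q q
    _∘_ : {p q r : Q₀} → Arr q r → Arr p q → Arr p r

    ∘-cong : {p q r : Q₀} {v v′ : Arr q r} {u u′ : Arr p q} →
             v ≈ v′ → u ≈ u′ → v ∘ u ≈ v′ ∘ u′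
    assoc  : {p q r s : Q₀} (w : Arr r s) (v : Arr q r) (u : Arr p q) →
             (w ∘ v) ∘ u ≈ w ∘ (v ∘ u)
    identityˡ : {p q : Q₀} (u : Arr p q) → 1ₐ q ∘ u ≈ u
    identityʳ : {p q : Q₀} (u : Arr p q) → u ∘ 1ₐ p ≈ u

    ∘-⋁ˡ : {p q r : Q₀} {I : Set ℓ} (v : I → Arr q r) (u : Arr p q) →
           ⋁ v ∘ u ≈ ⋁ (λ i → v i ∘ u)
    ∘-⋁ʳ : {p q r : Q₀} {I : Set ℓ} (v : Arr q r) (u : I → Arr p q) →
           v ∘ ⋁ u ≈ ⋁ (λ i → v ∘ u i)

  module Hom {p q : Q₀} = CompleteLattice (Hom p q)

  infixl 8 _↙_
  infixr 8 _↘_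

  _↙_ : {p q r : Q₀} → Arr p r → Arr p q → Arr q r
  _↙_ {p} {q} {r} w u = ⋁ {I = Σ[ v ∈ Arr q r ] v ∘ u ≤ w} proj₁

  _↘_ : {p q r : Q₀} → Arr q r → Arr p r → Arr p q
  _↘_ {p} {q} {r} v w = ⋁ {I = Σ[ u ∈ Arr p q ] v ∘ u ≤ w} proj₁

  ≤-refl : {p q : Q₀} {u : Arr p q} → u ≤ u
  ≤-refl = Hom.refl

  ≤-trans : {p q : Q₀} {u v w : Arr p q} → u ≤ v → v ≤ w → u ≤ w
  ≤-trans = Hom.trans

  ≈⇒≤ : {p q : Q₀} {u v : Arr p q} → u ≈ v → u ≤ v
  ≈⇒≤ = Hom.reflexive

  ≈⇒≥ : {p q : Q₀} {u v : Arr p q} → u ≈ v → v ≤ u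
  ≈⇒≥ e = Hom.reflexive (Hom.Eq.sym e)

  private
    pair : {p q : Q₀} → Arr p q → Arr p q → Lift ℓ Bool → Arr p q
    pair u u′ (lift true)  = u
    pair u u′ (lift false) = u′

    pair-⋁ : {p q : Q₀} {u u′ : Arr p q} → u ≤ u′ → u′ ≈ ⋁ (pair u u′)
    pair-⋁ {u = u} {u′} u≤u′ = Hom.antisym
      (Hom.⋁-upper (pair u u′) (lift false))
      (Hom.⋁-least (pair u u′) u′ λ { (lift true) → u≤u′ ; (lift false) → ≤-refl })

  ∘-monoʳ : {p q r : Q₀} (v : Arr q r) {u u′ : Arr p q} → u ≤ u′ → v ∘ u ≤ v ∘ u′
  ∘-monoʳ v {u} {u′} u≤u′ =
    ≤-trans (Hom.⋁-upper (λ i → v ∘ pair u u′ i) (lift true))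
    (≤-trans (≈⇒≥ (∘-⋁ʳ v (pair u u′)))
             (≈⇒≥ (∘-cong Hom.Eq.refl (pair-⋁ u≤u′))))

  ∘-monoˡ : {p q r : Q₀} {v v′ : Arr q r} (u : Arr p q) → v ≤ v′ → v ∘ u ≤ v′ ∘ u
  ∘-monoˡ {v = v} {v′} u v≤v′ =
    ≤-trans (Hom.⋁-upper (λ i → pair v v′ i ∘ u) (lift true))
    (≤-trans (≈⇒≥ (∘-⋁ˡ (pair v v′) u))
             (≈⇒≥ (∘-cong (pair-⋁ v≤v′) Hom.Eq.refl)))

  ∘-mono : {p q r : Q₀} {v v′ : Arr q r} {u u′ : Arr p q} →
           v ≤ v′ → u ≤ u′ → v ∘ u ≤ v′ ∘ u′
  ∘-mono {v′ = v′} {u} v≤v′ u≤u′ = ≤-trans (∘-monoˡ u v≤v′) (∘-monoʳ v′ u≤u′)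

  ↙-adjoint : {p q r : Q₀} (w : Arr p r) (u : Arr p q) (v : Arr q r) →
              (v ∘ u ≤ w) ⇔ (v ≤ w ↙ u)
  ↙-adjoint w u v = mk⇔
    (λ vu≤w → Hom.⋁-upper proj₁ (v , vu≤w))
    (λ v≤ → ≤-trans (∘-monoˡ u v≤)
              (≤-trans (≈⇒≤ (∘-⋁ˡ proj₁ u)) (Hom.⋁-least _ w proj₂)))

  ↘-adjoint : {p q r : Q₀} (v : Arr q r) (w : Arr p r) (u : Arr p q) →
              (v ∘ u ≤ w) ⇔ (u ≤ v ↘ w)
  ↘-adjoint v w u = mk⇔
    (λ vu≤w → Hom.⋁-upper proj₁ (u , vu≤w))
    (λ u≤ → ≤-trans (∘-monoʳ v u≤)
              (≤-trans (≈⇒≤ (∘-⋁ʳ v proj₁)) (Hom.⋁-least _ w proj₂)))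

  ↙-intro : {p q r : Q₀} {w : Arr p r} {u : Arr p q} {v : Arr q r} → v ∘ u ≤ w → v ≤ w ↙ u
  ↙-intro {w = w} {u} {v} = Equivalence.to (↙-adjoint w u v)

  ↙-elim : {p q r : Q₀} {w : Arr p r} {u : Arr p q} {v : Arr q r} → v ≤ w ↙ u → v ∘ u ≤ w
  ↙-elim {w = w} {u} {v} = Equivalence.from (↙-adjoint w u v)

  ↘-intro : {p q r : Q₀} {v : Arr q r} {w : Arr p r} {u : Arr p q} → v ∘ u ≤ w → u ≤ v ↘ w
  ↘-intro {v = v} {w} {u} = Equivalence.to (↘-adjoint v w u)

  ↘-elim : {p q r : Q₀} {v : Arr q r} {w : Arr p r} {u : Arr p q} → u ≤ v ↘ w → v ∘ u ≤ w
  ↘-elim {v = v} {w} {u} = Equivalence.from (↘-adjoint v w u)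

-- A set with a type map into Q₀ is presented by its fibres: T q is the set of
-- elements of type q.  A type-preserving map then acts fibrewise.
TypedSet : ∀ {ℓ} → Quantaloid ℓ → Set (suc ℓ)
TypedSet {ℓ} Q = Quantaloid.Q₀ Q → Setoid ℓ ℓ

record TypedMap {ℓ} (Q : Quantaloid ℓ) (S T : TypedSet Q) : Set ℓ where
  open Quantaloid Q using (Q₀)
  field
    map  : {q : Q₀} → Setoid.Carrier (S q) → Setoid.Carrier (T q)
    cong : {q : Q₀} {x y : Setoid.Carrier (S q)} →
           Setoid._≈_ (S q) x y → Setoid._≈_ (T q) (map x) (map y)

record QCategory {ℓ} (Q : Quantaloid ℓ) : Set (suc ℓ) where
  open Quantaloid Q
  field
    objects : TypedSet Q

  Obj : Q₀ → Set ℓ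
  Obj q = Setoid.Carrier (objects q)

  infix 4 _≋_ _⊑_ _≅_
  _≋_ : {q : Q₀} → Obj q → Obj q → Set ℓ
  _≋_ {q} = Setoid._≈_ (objects q)

  field
    hom      : {p q : Q₀} → Obj p → Obj q → Arr p q
    hom-cong : {p q : Q₀} {x x′ : Obj p} {y y′ : Obj q} →
               x ≋ x′ → y ≋ y′ → hom x y ≈ hom x′ y′
    hom-id   : {q : Q₀} (x : Obj q) → 1ₐ q ≤ hom x x
    hom-comp : {p q r : Q₀} (x : Obj p) (y : Obj q) (z : Obj r) →
               hom y z ∘ hom x y ≤ hom x z

  -- The underlying preorder; objects of different types are not comparable.
  _⊑_ : {q : Q₀} → Obj q → Obj q → Set ℓ
  _⊑_ {q} x y = 1ₐ q ≤ hom x y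

  _≅_ : {q : Q₀} → Obj q → Obj q → Set ℓ
  x ≅ y = (x ⊑ y) × (y ⊑ x)

  IsJoin : {q : Q₀} {I : Set ℓ} → (I → Obj q) → Obj q → Set ℓ
  IsJoin x y = (∀ i → x i ⊑ y) × (∀ z → (∀ i → x i ⊑ z) → y ⊑ z)

  IsMeet : {q : Q₀} {I : Set ℓ} → (I → Obj q) → Obj q → Set ℓ
  IsMeet x y = (∀ i → y ⊑ x i) × (∀ z → (∀ i → z ⊑ x i) → z ⊑ y)

module _ {ℓ : Level} {Q : Quantaloid ℓ} where
  open Quantaloid Q

  Separated : QCategory Q → Set ℓ
  Separated 𝔸 = {q : Q₀} (x y : Obj q) → x ≅ y → x ≋ y
    where open QCategory 𝔸

  Subcategory : (𝔸 : QCategory Q) → ({q : Q₀} → QCategory.Obj 𝔸 q → Set ℓ) → QCategory Q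
  Subcategory 𝔸 P = record
    { objects  = λ q → record
        { Carrier       = Σ (Obj q) P
        ; _≈_           = λ x y → proj₁ x ≋ proj₁ y
        ; isEquivalence = record
            { refl  = Setoid.refl (objects q)
            ; sym   = Setoid.sym (objects q)
            ; trans = Setoid.trans (objects q)
            }
        }
    ; hom      = λ x y → hom (proj₁ x) (proj₁ y)
    ; hom-cong = hom-cong
    ; hom-id   = λ x → hom-id (proj₁ x)
    ; hom-comp = λ x y z → hom-comp (proj₁ x) (proj₁ y) (proj₁ z)
    }
    where open QCategory 𝔸

  record QFunctor (𝔸 𝔹 : QCategory Q) : Set ℓ where
    private
      module 𝔸 = QCategory 𝔸
      module 𝔹 = QCategory 𝔹
    field
      typedMap : TypedMap Q 𝔸.objects 𝔹.objects
    open TypedMap typedMap public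
    field
      hom-≤ : {p q : Q₀} (x : 𝔸.Obj p) (y : 𝔸.Obj q) → 𝔸.hom x y ≤ 𝔹.hom (map x) (map y)

  record Isomorphic (𝔸 𝔹 : QCategory Q) : Set ℓ where
    private
      module 𝔸 = QCategory 𝔸
      module 𝔹 = QCategory 𝔹
    field
      to      : QFunctor 𝔸 𝔹
      from    : QFunctor 𝔹 𝔸
      from-to : {q : Q₀} (x : 𝔸.Obj q) → QFunctor.map from (QFunctor.map to x) 𝔸.≋ x
      to-from : {q : Q₀} (y : 𝔹.Obj q) → QFunctor.map to (QFunctor.map from y) 𝔹.≋ y

  record Distributor (𝔸 𝔹 : QCategory Q) : Set ℓ where
    private
      module 𝔸 = QCategory 𝔸
      module 𝔹 = QCategory 𝔹
    field
      at  : {p q : Q₀} → 𝔸.Obj p → 𝔹.Obj q → Arr p q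
      act : {p p′ q q′ : Q₀} (x : 𝔸.Obj p) (x′ : 𝔸.Obj p′) (y : 𝔹.Obj q) (y′ : 𝔹.Obj q′) →
            𝔹.hom y y′ ∘ at x y ∘ 𝔸.hom x′ x ≤ at x′ y′

    actˡ : {p q q′ : Q₀} (x : 𝔸.Obj p) (y : 𝔹.Obj q) (y′ : 𝔹.Obj q′) →
           𝔹.hom y y′ ∘ at x y ≤ at x y′
    actˡ x y y′ =
      ≤-trans (∘-monoʳ _ (≤-trans (≈⇒≥ (identityʳ _)) (∘-monoʳ _ (𝔸.hom-id x)))) (act x x y y′)

    actʳ : {p p′ q : Q₀} (x : 𝔸.Obj p) (x′ : 𝔸.Obj p′) (y : 𝔹.Obj q) →
           at x y ∘ 𝔸.hom x′ x ≤ at x′ y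
    actʳ x x′ y =
      ≤-trans (≤-trans (≈⇒≥ (identityˡ _)) (∘-monoˡ _ (𝔹.hom-id y))) (act x x′ y y)

  open Distributor using (at)

  infix 4 _≈ᵈ_
  _≈ᵈ_ : {𝔸 𝔹 : QCategory Q} → Distributor 𝔸 𝔹 → Distributor 𝔸 𝔹 → Set ℓ
  _≈ᵈ_ {𝔸} {𝔹} φ ψ = {p q : Q₀} (x : QCategory.Obj 𝔸 p) (y : QCategory.Obj 𝔹 q) →
                     at φ x y ≈ at ψ x y

  identityᵈ : (𝔸 : QCategory Q) → Distributor 𝔸 𝔸
  identityᵈ 𝔸 = record
    { at  = hom
    ; act = λ x x′ y y′ → ≤-trans (∘-monoʳ _ (hom-comp x′ x y)) (hom-comp x′ y y′)
    }
    where open QCategory 𝔸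

  infixl 8 _↙ᵈ_
  infixr 8 _↘ᵈ_

  _↙ᵈ_ : {𝔸 𝔹 ℂ : QCategory Q} → Distributor 𝔸 ℂ → Distributor 𝔸 𝔹 → Distributor 𝔹 ℂ
  _↙ᵈ_ {𝔸} {𝔹} {ℂ} ξ φ = record
    { at  = impl
    ; act = λ y y′ z z′ → Hom.⋀-greatest _ _ λ { (p , x) → ↙-intro
        (≤-trans (≈⇒≤ (assoc _ _ _))
        (≤-trans (∘-monoʳ _ (≤-trans (≈⇒≤ (assoc _ _ _))
          (≤-trans (∘-mono (Hom.⋀-lower _ (p , x)) (φ.actˡ x y′ y)) (↙-elim ≤-refl))))
        (ξ.actˡ x z z′))) }
    }
    where
    module 𝔸 = QCategory 𝔸
    module 𝔹 = QCategory 𝔹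
    module ℂ = QCategory ℂ
    module φ = Distributor φ
    module ξ = Distributor ξ
    impl : {q r : Q₀} → 𝔹.Obj q → ℂ.Obj r → Arr q r
    impl y z = ⋀ {I = Σ Q₀ 𝔸.Obj} λ (p , x) → ξ.at x z ↙ φ.at x y

  _↘ᵈ_ : {𝔸 𝔹 ℂ : QCategory Q} → Distributor 𝔹 ℂ → Distributor 𝔸 ℂ → Distributor 𝔸 𝔹
  _↘ᵈ_ {𝔸} {𝔹} {ℂ} ψ ξ = record
    { at  = impl
    ; act = λ x x′ y y′ → Hom.⋀-greatest _ _ λ { (r , z) → ↘-intro
        (≤-trans (≈⇒≥ (assoc _ _ _))
        (≤-trans (∘-monoˡ _ (ψ.actʳ y′ y z))
        (≤-trans (≈⇒≥ (assoc _ _ _))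
        (≤-trans (∘-monoˡ _ (≤-trans (∘-monoʳ _ (Hom.⋀-lower _ (r , z))) (↘-elim ≤-refl)))
        (ξ.actʳ x x′ z))))) }
    }
    where
    module 𝔸 = QCategory 𝔸
    module 𝔹 = QCategory 𝔹
    module ℂ = QCategory ℂ
    module ψ = Distributor ψ
    module ξ = Distributor ξ
    impl : {p q : Q₀} → 𝔸.Obj p → 𝔹.Obj q → Arr p q
    impl x y = ⋀ {I = Σ Q₀ ℂ.Obj} λ (r , z) → ψ.at y z ↘ ξ.at x z

  -- {q}: its fibre over r is q ≡ r, so that refl is its only object.
  ⋆ : Q₀ → QCategory Q
  ⋆ q = record
    { objects  = λ r → ≡.setoid (q ≡ r)
    ; hom      = λ { refl refl → 1ₐ q }
    ; hom-cong = λ { refl refl → Hom.Eq.refl }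
    ; hom-id   = λ { refl → ≤-refl }
    ; hom-comp = λ { refl refl refl → ≈⇒≤ (identityˡ _) }
    }

  Presheaf : QCategory Q → Q₀ → Set ℓ
  Presheaf 𝔸 q = Distributor 𝔸 (⋆ q)

  Copresheaf : QCategory Q → Q₀ → Set ℓ
  Copresheaf 𝔸 q = Distributor (⋆ q) 𝔸

  𝖯 : QCategory Q → QCategory Q
  𝖯 𝔸 = record
    { objects  = λ q → record
        { Carrier       = Presheaf 𝔸 q
        ; _≈_           = _≈ᵈ_
        ; isEquivalence = record
            { refl  = λ x y → Hom.Eq.refl
            ; sym   = λ e x y → Hom.Eq.sym (e x y)
            ; trans = λ e e′ x y → Hom.Eq.trans (e x y) (e′ x y)
            }
        }
    ; hom      = homᴾ
    ; hom-cong = λ {_} {_} {μ} {μ′} {ν} {ν′} e e′ → Hom.antisym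
        (mono {μ = μ} {μ′} {ν} {ν′} (λ x → ≈⇒≥ (e x refl)) (λ x → ≈⇒≤ (e′ x refl)))
        (mono {μ = μ′} {μ} {ν′} {ν} (λ x → ≈⇒≤ (e x refl)) (λ x → ≈⇒≥ (e′ x refl)))
    ; hom-id   = λ μ → Hom.⋀-greatest _ _ λ i → ↙-intro (≈⇒≤ (identityˡ _))
    ; hom-comp = λ μ ν ξ → Hom.⋀-greatest _ _ λ i → ↙-intro
        (≤-trans (≈⇒≤ (assoc _ _ _))
        (≤-trans (∘-monoʳ _ (↙-elim (Hom.⋀-lower _ i))) (↙-elim (Hom.⋀-lower _ i))))
    }
    where
    open QCategory 𝔸 using (Obj)
    homᴾ : {p q : Q₀} → Presheaf 𝔸 p → Presheaf 𝔸 q → Arr p q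
    homᴾ μ μ′ = at (μ′ ↙ᵈ μ) refl refl

    mono : {p q : Q₀} {μ μ′ : Presheaf 𝔸 p} {ν ν′ : Presheaf 𝔸 q} →
           (∀ {r} (x : Obj r) → at μ′ x refl ≤ at μ x refl) →
           (∀ {r} (x : Obj r) → at ν x refl ≤ at ν′ x refl) →
           homᴾ μ ν ≤ homᴾ μ′ ν′
    mono f g = Hom.⋀-greatest _ _ λ { (r , x) → ↙-intro
      (≤-trans (∘-monoʳ _ (f x)) (≤-trans (↙-elim (Hom.⋀-lower _ (r , x))) (g x))) }

  IsSup : (𝔸 : QCategory Q) {q : Q₀} → Presheaf 𝔸 q → QCategory.Obj 𝔸 q → Set ℓ
  IsSup 𝔸 μ s = {r : Q₀} (y : Obj r) → hom s y ≈ at (identityᵈ 𝔸 ↙ᵈ μ) refl y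
    where open QCategory 𝔸

  Complete : QCategory Q → Set ℓ
  Complete 𝔸 = {q : Q₀} (μ : Presheaf 𝔸 q) → ∃ (IsSup 𝔸 μ)

  infixr 7 _↑_ _↓_

  _↑_ : {𝔸 𝔹 : QCategory Q} → Distributor 𝔸 𝔹 → {q : Q₀} → Presheaf 𝔸 q → Copresheaf 𝔹 q
  φ ↑ μ = φ ↙ᵈ μ

  _↓_ : {𝔸 𝔹 : QCategory Q} → Distributor 𝔸 𝔹 → {q : Q₀} → Copresheaf 𝔹 q → Presheaf 𝔸 q
  φ ↓ ν = ν ↘ᵈ φ

  𝖬 : {𝔸 𝔹 : QCategory Q} → Distributor 𝔸 𝔹 → QCategory Q
  𝖬 {𝔸} φ = Subcategory (𝖯 𝔸) λ μ → φ ↓ φ ↑ μ ≈ᵈ μ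

  module _ (𝔸 : QCategory Q) where
    open QCategory 𝔸

    data DomEq {q : Q₀} : (x y : Σ[ p ∈ Q₀ ] Obj p × Arr p q) → Set ℓ where
      eq : {p : Q₀} {a a′ : Obj p} {u u′ : Arr p q} →
           a ≋ a′ → u ≈ u′ → DomEq (p , a , u) (p , a′ , u′)

    data CodEq {q : Q₀} : (x y : Σ[ p ∈ Q₀ ] Obj p × Arr q p) → Set ℓ where
      eq : {p : Q₀} {b b′ : Obj p} {v v′ : Arr q p} →
           b ≋ b′ → v ≈ v′ → CodEq (p , b , v) (p , b′ , v′)

    -- An element (p , a , u) of type q is a pair (a , u) with ∣a∣ = p = dom u, cod u = q.
    _×dom : TypedSet Q
    _×dom q = record
      { Carrier       = Σ[ p ∈ Q₀ ] Obj p × Arr p q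
      ; _≈_           = DomEq
      ; isEquivalence = record
          { refl  = λ { {p , a , u} → eq (Setoid.refl (objects p)) Hom.Eq.refl }
          ; sym   = λ { (eq {p} e f) → eq (Setoid.sym (objects p) e) (Hom.Eq.sym f) }
          ; trans = λ { (eq {p} e f) (eq e′ f′) →
                        eq (Setoid.trans (objects p) e e′) (Hom.Eq.trans f f′) }
          }
      }

    -- An element (p , b , v) of type q is a pair (b , v) with ∣b∣ = p = cod v, dom v = q.
    _×cod : TypedSet Q
    _×cod q = record
      { Carrier       = Σ[ p ∈ Q₀ ] Obj p × Arr q p
      ; _≈_           = CodEq
      ; isEquivalence = record
          { refl  = λ { {p , b , v} → eq (Setoid.refl (objects p)) Hom.Eq.refl }
          ; sym   = λ { (eq {p} e f) → eq (Setoid.sym (objects p) e) (Hom.Eq.sym f) }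
          ; trans = λ { (eq {p} e f) (eq e′ f′) →
                        eq (Setoid.trans (objects p) e e′) (Hom.Eq.trans f f′) }
          }
      }

  module _ {S : TypedSet Q} (𝕏 : QCategory Q) (F : TypedMap Q S (QCategory.objects 𝕏)) where
    open QCategory 𝕏
    open TypedMap F

    ⋁-Dense : Set (suc ℓ)
    ⋁-Dense = {q : Q₀} (y : Obj q) →
              Σ[ I ∈ Set ℓ ] Σ[ x ∈ (I → Setoid.Carrier (S q)) ] IsJoin (map ∘′ x) y

    ⋀-Dense : Set (suc ℓ)
    ⋀-Dense = {q : Q₀} (y : Obj q) →
              Σ[ I ∈ Set ℓ ] Σ[ x ∈ (I → Setoid.Carrier (S q)) ] IsMeet (map ∘′ x) y

{-# OPTIONS --safe #-}
module Submission where

-- Both directions rest on computing the hom-arrows of a category from its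
-- values at the objects F (a , u) and G (b , v).
--
-- Only if.  In 𝖬 φ let F (a , u) be the polar φ ↓ (φ(a,-) ↙ u), which is the
-- closure of the presheaf u ∘ 𝔸(-,a), and let G (b , v) be v ↘ φ(-,b).  Then
-- every closed presheaf ν satisfies 𝖬φ (F (a , u) , ν) = ν(a) ↙ u and
-- 𝖬φ (ν , G (b , v)) = v ↘ (φ ↑ ν)(b) (generator-hom, cogenerator-hom).
-- Taking ν = G (b , v) in the first identity yields the required equation.
-- The first also shows that ν is the join of all F (a , ν(a)), and the second
-- that ν is the meet of all G (b , (φ ↑ ν)(b)).  Isomorphisms preserve all of
-- this.
--
-- If.  In a complete 𝒬-category the colimit of any weighted family exists
-- (weightedSup), whence joins and meets of the underlying preorder are
-- preserved by the hom-arrows (join-hom, meet-hom).  Write Fa = F (a , 1) and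
-- Gb = G (b , 1), so that 𝕏(Fa , Gb) = φ(a,b).  Density and the equation give
-- 𝕏(F (a , u) , y) = 𝕏(Fa , y) ↙ u and 𝕏(x , G (b , v)) = v ↘ 𝕏(x , Gb), and
-- hence the presheaves 𝕏(F- , x) and the copresheaves 𝕏(x , G-) both determine
-- the hom-arrows of 𝕏:
--     𝕏(x,y) = ⋀ₐ 𝕏(Fa , y) ↙ 𝕏(Fa , x) = ⋀_b 𝕏(y , Gb) ↘ 𝕏(x , Gb)
-- (reflect-F, reflect-G).  Putting y = Gb in the first identity and x = Fa in
-- the second shows that φ ↑ and φ ↓ interchange 𝕏(F- , x) and 𝕏(x , G-).  So
-- 𝕏(F- , x) is closed, and x ↦ 𝕏(F- , x) is a fully faithful functor to 𝖬 φ.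
-- It hits every closed μ: if s is the colimit of F weighted by μ, then
-- 𝕏(s , G-) = φ ↑ μ, and so 𝕏(F- , s) = φ ↓ φ ↑ μ = μ.  Separatedness turns
-- this equivalence into an isomorphism.

open import Defs
open import Level using (Level; Lift; lift)
open import Data.Product using (Σ; Σ-syntax; _×_; _,_; proj₁; proj₂)
open import Data.Unit.Base using (⊤; tt)
open import Function.Bundles using (_⇔_; mk⇔; module Equivalence)
open import Relation.Binary.Bundles using (Setoid)
open import Relation.Binary.PropositionalEquality using (refl)

open Equivalence using (to; from)

-- Order calculus in a quantaloid

module QuantaloidProperties {ℓ : Level} (Q : Quantaloid ℓ) where
  open Quantaloid Q

  assoc-≤ : {p q r s : Q₀} {w : Arr r s} {v : Arr q r} {u : Arr p q} →
            (w ∘ v) ∘ u ≤ w ∘ (v ∘ u)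
  assoc-≤ = ≈⇒≤ (assoc _ _ _)

  assoc-≥ : {p q r s : Q₀} {w : Arr r s} {v : Arr q r} {u : Arr p q} →
            w ∘ (v ∘ u) ≤ (w ∘ v) ∘ u
  assoc-≥ = ≈⇒≥ (assoc _ _ _)

  1∘-≤ : {p q : Q₀} {u : Arr p q} → 1ₐ q ∘ u ≤ u
  1∘-≤ = ≈⇒≤ (identityˡ _)

  1∘-≥ : {p q : Q₀} {u : Arr p q} → u ≤ 1ₐ q ∘ u
  1∘-≥ = ≈⇒≥ (identityˡ _)

  ∘1-≤ : {p q : Q₀} {u : Arr p q} → u ∘ 1ₐ p ≤ u
  ∘1-≤ = ≈⇒≤ (identityʳ _)

  ∘1-≥ : {p q : Q₀} {u : Arr p q} → u ≤ u ∘ 1ₐ p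
  ∘1-≥ = ≈⇒≥ (identityʳ _)

  ↙-eval : {p q r : Q₀} {w : Arr p r} {u : Arr p q} → (w ↙ u) ∘ u ≤ w
  ↙-eval = ↙-elim ≤-refl

  ↘-eval : {p q r : Q₀} {v : Arr q r} {w : Arr p r} → v ∘ (v ↘ w) ≤ w
  ↘-eval = ↘-elim ≤-refl

  ↘-↙-comm : {p q r s : Q₀} (v : Arr r s) (w : Arr p s) (u : Arr p q) →
             v ↘ (w ↙ u) ≈ (v ↘ w) ↙ u
  ↘-↙-comm v w u = Hom.antisym
    (↙-intro (↘-intro (≤-trans assoc-≥ (↙-elim ↘-eval))))
    (↘-intro (↙-intro (≤-trans assoc-≤ (↘-elim ↙-eval))))

  ≤-↘-↙ : {p q r s : Q₀} {v : Arr r s} {w : Arr p s} {u : Arr p q} {t : Arr q r} →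
          (t ≤ v ↘ (w ↙ u)) ⇔ (v ∘ (t ∘ u) ≤ w)
  ≤-↘-↙ = mk⇔
    (λ h → ≤-trans assoc-≥ (↙-elim (↘-elim h)))
    (λ h → ↘-intro (↙-intro (≤-trans assoc-≤ h)))

-- Functors and isomorphisms

module _ {ℓ : Level} {Q : Quantaloid ℓ} where
  open Quantaloid Q
  open QuantaloidProperties Q

  -- Composition of type-preserving maps.
  _∘ᵗ_ : {S T U : TypedSet Q} → TypedMap Q T U → TypedMap Q S T → TypedMap Q S U
  G ∘ᵗ F = record
    { map  = λ x → TypedMap.map G (TypedMap.map F x)
    ; cong = λ e → TypedMap.cong G (TypedMap.cong F e)
    }

  module QCategoryProperties (𝕏 : QCategory Q) where
    open QCategory 𝕏 public

    ≋-refl : {q : Q₀} {x : Obj q} → x ≋ x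
    ≋-refl {q} = Setoid.refl (objects q)

    ≋-sym : {q : Q₀} {x y : Obj q} → x ≋ y → y ≋ x
    ≋-sym {q} = Setoid.sym (objects q)

    ≋⇒⊑ : {q : Q₀} {x y : Obj q} → x ≋ y → x ⊑ y
    ≋⇒⊑ e = ≤-trans (hom-id _) (≈⇒≤ (hom-cong ≋-refl e))

    ∘-⊑ : {p q r : Q₀} {x : Obj p} {y : Obj q} {z : Obj r} {f : Arr q r} {g : Arr p q} →
          f ≤ hom y z → g ≤ hom x y → f ∘ g ≤ hom x z
    ∘-⊑ f≤ g≤ = ≤-trans (∘-mono f≤ g≤) (hom-comp _ _ _)

    hom-⊑ˡ : {q r : Q₀} {x y : Obj q} {z : Obj r} {w : Arr q r} → x ⊑ y → w ≤ hom y z → w ≤ hom x z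
    hom-⊑ˡ x⊑y w≤ = ≤-trans ∘1-≥ (∘-⊑ w≤ x⊑y)

  module _ {𝕏 𝕐 : QCategory Q} where
    private
      module 𝕏 = QCategoryProperties 𝕏
      module 𝕐 = QCategoryProperties 𝕐

    fullyFaithful∧surjective⇒isomorphic :
      Separated 𝕏 → (T : QFunctor 𝕏 𝕐) →
      ({p q : Q₀} (x : 𝕏.Obj p) (y : 𝕏.Obj q) →
        𝕐.hom (QFunctor.map T x) (QFunctor.map T y) ≤ 𝕏.hom x y) →
      ({q : Q₀} (y : 𝕐.Obj q) → Σ[ x ∈ 𝕏.Obj q ] QFunctor.map T x 𝕐.≋ y) →
      Isomorphic 𝕏 𝕐
    fullyFaithful∧surjective⇒isomorphic sep T full surj = record
      { to      = T
      ; from    = record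
          { typedMap = record
              { map  = inv
              ; cong = λ e → sep _ _ (inv-⊑ (𝕐.≋⇒⊑ e) , inv-⊑ (𝕐.≋⇒⊑ (𝕐.≋-sym e)))
              }
          ; hom-≤    = inv-hom
          }
      ; from-to = λ x → sep _ _
          ( ≤-trans (𝕐.≋⇒⊑ (T-inv (map x))) (full _ _)
          , ≤-trans (𝕐.≋⇒⊑ (𝕐.≋-sym (T-inv (map x)))) (full _ _) )
      ; to-from = T-inv
      }
      where
      open QFunctor T using (map)

      inv : {q : Q₀} → 𝕐.Obj q → 𝕏.Obj q
      inv y = proj₁ (surj y)

      T-inv : {q : Q₀} (y : 𝕐.Obj q) → map (inv y) 𝕐.≋ y
      T-inv y = proj₂ (surj y)

      inv-hom : {p q : Q₀} (y : 𝕐.Obj p) (z : 𝕐.Obj q) → 𝕐.hom y z ≤ 𝕏.hom (inv y) (inv z)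
      inv-hom y z = ≤-trans (≈⇒≥ (𝕐.hom-cong (T-inv y) (T-inv z))) (full _ _)

      inv-⊑ : {q : Q₀} {y z : 𝕐.Obj q} → y 𝕐.⊑ z → inv y 𝕏.⊑ inv z
      inv-⊑ y⊑z = ≤-trans y⊑z (inv-hom _ _)

    module _ (iso : Isomorphic 𝕏 𝕐) where
      private
        module T = QFunctor (Isomorphic.to iso)
        module U = QFunctor (Isomorphic.from iso)
      open Isomorphic iso using (from-to; to-from)

      isomorphic-hom : {p q : Q₀} (y : 𝕐.Obj p) (z : 𝕐.Obj q) →
                       𝕐.hom y z ≈ 𝕏.hom (U.map y) (U.map z)
      isomorphic-hom y z = Hom.antisym (U.hom-≤ y z)
        (≤-trans (T.hom-≤ _ _) (≈⇒≤ (𝕐.hom-cong (to-from y) (to-from z))))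

      private
        ⊑-T : {q : Q₀} {x z : 𝕏.Obj q} → T.map x 𝕐.⊑ T.map z → x 𝕏.⊑ z
        ⊑-T h = ≤-trans h (≤-trans (U.hom-≤ _ _) (≈⇒≤ (𝕏.hom-cong (from-to _) (from-to _))))

        U-⊑ : {q : Q₀} {y : 𝕐.Obj q} {x : 𝕏.Obj q} → (y 𝕐.⊑ T.map x) ⇔ (U.map y 𝕏.⊑ x)
        U-⊑ = mk⇔
          (λ h → ≤-trans h (≤-trans (U.hom-≤ _ _) (≈⇒≤ (𝕏.hom-cong 𝕏.≋-refl (from-to _)))))
          (λ h → ≤-trans h (≤-trans (T.hom-≤ _ _) (≈⇒≤ (𝕐.hom-cong (to-from _) 𝕐.≋-refl))))

        ⊑-U : {q : Q₀} {y : 𝕐.Obj q} {x : 𝕏.Obj q} → (T.map x 𝕐.⊑ y) ⇔ (x 𝕏.⊑ U.map y)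
        ⊑-U = mk⇔
          (λ h → ≤-trans h (≤-trans (U.hom-≤ _ _) (≈⇒≤ (𝕏.hom-cong (from-to _) 𝕏.≋-refl))))
          (λ h → ≤-trans h (≤-trans (T.hom-≤ _ _) (≈⇒≤ (𝕐.hom-cong 𝕐.≋-refl (to-from _)))))

      isomorphic-⋁-Dense : {S : TypedSet Q} (F : TypedMap Q S 𝕐.objects) →
                           ⋁-Dense 𝕐 F → ⋁-Dense 𝕏 (U.typedMap ∘ᵗ F)
      isomorphic-⋁-Dense F dense x with dense (T.map x)
      ... | I , f , upper , least = I , f , (λ i → to U-⊑ (upper i)) ,
            λ z h → ⊑-T (least (T.map z) (λ i → from U-⊑ (h i)))

      isomorphic-⋀-Dense : {S : TypedSet Q} (G : TypedMap Q S 𝕐.objects) →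
                           ⋀-Dense 𝕐 G → ⋀-Dense 𝕏 (U.typedMap ∘ᵗ G)
      isomorphic-⋀-Dense G dense x with dense (T.map x)
      ... | I , g , lower , greatest = I , g , (λ i → to ⊑-U (lower i)) ,
            λ z h → ⊑-T (greatest (T.map z) (λ i → from ⊑-U (h i)))

-- Weighted colimits in a complete category

  module _ {𝕏 : QCategory Q} where
    open QCategoryProperties 𝕏

    -- A presheaf given by its values at the unique object refl of the codomain.
    presheaf : {q : Q₀} (f : {p : Q₀} → Obj p → Arr p q) →
               ({p p′ : Q₀} (x : Obj p) (x′ : Obj p′) → f x ∘ hom x′ x ≤ f x′) →
               Presheaf 𝕏 q
    presheaf f f-act = record
      { at  = λ { x refl → f x }
      ; act = λ { x x′ refl refl → ≤-trans 1∘-≤ (f-act x x′) }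
      }

    -- Dually for copresheaves.
    copresheaf : {q : Q₀} (f : {p : Q₀} → Obj p → Arr q p) →
                 ({p p′ : Q₀} (x : Obj p) (x′ : Obj p′) → hom x x′ ∘ f x ≤ f x′) →
                 Copresheaf 𝕏 q
    copresheaf f f-act = record
      { at  = λ { refl x → f x }
      ; act = λ { refl refl x x′ → ≤-trans (∘-monoʳ _ ∘1-≤) (f-act x x′) }
      }

  module CompleteProperties {𝕏 : QCategory Q} (complete : Complete 𝕏) where
    open QCategoryProperties 𝕏

    -- The colimit of a family x i weighted by arrows u i, characterised by
    -- 𝕏(s,z) = ⋀ᵢ 𝕏(x i,z) ↙ u i.  It is the supremum of the presheaf
    -- ⋁ᵢ u i ∘ 𝕏(-,x i).  Joins, tensors and weighted colimits of functors are
    -- all instances.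
    weightedSup : {I : Set ℓ} {p : I → Q₀} {q : Q₀} (x : (i : I) → Obj (p i))
                  (u : (i : I) → Arr (p i) q) →
                  Σ[ s ∈ Obj q ] ({r : Q₀} {z : Obj r} {w : Arr q r} →
                    (w ≤ hom s z) ⇔ (∀ i → w ∘ u i ≤ hom (x i) z))
    weightedSup {I} {q = q} x u = s , mk⇔
      (λ w≤ i → ≤-trans (∘-monoʳ _ (u≤weight i))
        (↙-elim (≤-trans w≤ (≤-trans (≈⇒≤ (isSup _)) (Hom.⋀-lower _ (_ , x i))))))
      (λ h → ≤-trans
        (Hom.⋀-greatest _ _ λ { (_ , t) → ↙-intro
          (≤-trans (≈⇒≤ (∘-⋁ʳ _ _)) (Hom.⋁-least _ _ λ i →
            ≤-trans assoc-≥ (∘-⊑ (h i) ≤-refl))) })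
        (≈⇒≥ (isSup _)))
      where
      weight : {p : Q₀} → Obj p → Arr p q
      weight t = ⋁ (λ i → u i ∘ hom t (x i))

      μ : Presheaf 𝕏 q
      μ = presheaf weight λ t t′ →
        ≤-trans (≈⇒≤ (∘-⋁ˡ _ _)) (Hom.⋁-least _ _ λ i →
          ≤-trans assoc-≤ (≤-trans (∘-monoʳ _ (hom-comp _ _ _)) (Hom.⋁-upper _ i)))

      s : Obj q
      s = proj₁ (complete μ)

      isSup : IsSup 𝕏 μ s
      isSup = proj₂ (complete μ)

      u≤weight : ∀ i → u i ≤ weight (x i)
      u≤weight i = ≤-trans ∘1-≥ (≤-trans (∘-monoʳ _ (hom-id (x i))) (Hom.⋁-upper _ i))

    -- The join y lies below the conical colimit of the family, which exists.
    join-hom : {I : Set ℓ} {q r : Q₀} {x : I → Obj q} {y : Obj q} {z : Obj r} {w : Arr q r} →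
               IsJoin x y → (∀ i → w ≤ hom (x i) z) → w ≤ hom y z
    join-hom {x = x} (_ , least) h with weightedSup x (λ _ → 1ₐ _)
    ... | s , s-hom = hom-⊑ˡ
          (least s (λ i → ≤-trans ∘1-≥ (to s-hom (hom-id s) i)))
          (from s-hom (λ i → ≤-trans ∘1-≤ (h i)))

    -- For the tensor t of z by w, w ≤ 𝕏(z,y) means t ⊑ y.
    meet-hom : {I : Set ℓ} {q r : Q₀} {x : I → Obj q} {y : Obj q} {z : Obj r} {w : Arr r q} →
               IsMeet x y → (∀ i → w ≤ hom z (x i)) → w ≤ hom z y
    meet-hom {z = z} {w} (_ , greatest) h with weightedSup {I = Lift ℓ ⊤} (λ _ → z) (λ _ → w)
    ... | t , t-hom = ≤-trans 1∘-≥
          (to t-hom (greatest t (λ i → from t-hom (λ _ → ≤-trans 1∘-≤ (h i)))) (lift tt))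

-- Closed presheaves of a distributor

  module ClosedPresheaves {𝔸 𝔹 : QCategory Q} (φ : Distributor 𝔸 𝔹) where
    private
      module 𝔸 = QCategoryProperties 𝔸
      module 𝔹 = QCategoryProperties 𝔹
      module 𝖬φ = QCategoryProperties (𝖬 φ)
      module φ = Distributor φ

    -- The value of a presheaf at an object.
    infix 20 _[_]
    _[_] : {𝔸 : QCategory Q} {p q : Q₀} → Presheaf 𝔸 q → QCategory.Obj 𝔸 p → Arr p q
    μ [ x ] = Distributor.at μ x refl

    -- The condition that cuts out 𝖬 φ from 𝖯 𝔸.
    Closed : {q : Q₀} → Presheaf 𝔸 q → Set ℓ
    Closed μ = φ ↓ φ ↑ μ ≈ᵈ μ

    -- The value of φ ↑ μ at y.
    polar : {q r : Q₀} → Presheaf 𝔸 q → 𝔹.Obj r → Arr q r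
    polar μ y = Distributor.at (φ ↑ μ) refl y

    ≤-polar : {q r : Q₀} {μ : Presheaf 𝔸 q} {y : 𝔹.Obj r} {w : Arr q r} →
              (w ≤ polar μ y) ⇔ ({p : Q₀} (x : 𝔸.Obj p) → w ∘ μ [ x ] ≤ φ.at x y)
    ≤-polar = mk⇔
      (λ h {_} x → ↙-elim (≤-trans h (Hom.⋀-lower _ (_ , x))))
      (λ h → Hom.⋀-greatest _ _ λ { (_ , x) → ↙-intro (h x) })

    ≤-↓ : {p q : Q₀} {κ : Copresheaf 𝔹 q} {x : 𝔸.Obj p} {w : Arr p q} →
          (w ≤ (φ ↓ κ) [ x ]) ⇔
          ({r : Q₀} (y : 𝔹.Obj r) → Distributor.at κ refl y ∘ w ≤ φ.at x y)
    ≤-↓ = mk⇔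
      (λ h {_} y → ↘-elim (≤-trans h (Hom.⋀-lower _ (_ , y))))
      (λ h → Hom.⋀-greatest _ _ λ { (_ , y) → ↘-intro (h y) })

    ≤-𝖯-hom : {q r : Q₀} {μ : Presheaf 𝔸 q} {ν : Presheaf 𝔸 r} {w : Arr q r} →
              (w ≤ QCategory.hom (𝖯 𝔸) μ ν) ⇔
              ({p : Q₀} (x : 𝔸.Obj p) → w ∘ μ [ x ] ≤ ν [ x ])
    ≤-𝖯-hom = mk⇔
      (λ h {_} x → ↙-elim (≤-trans h (Hom.⋀-lower _ (_ , x))))
      (λ h → Hom.⋀-greatest _ _ λ { (_ , x) → ↙-intro (h x) })

    polar-∘ : {q r : Q₀} (μ : Presheaf 𝔸 q) (y : 𝔹.Obj r) {p : Q₀} (x : 𝔸.Obj p) →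
              polar μ y ∘ μ [ x ] ≤ φ.at x y
    polar-∘ μ y = to (≤-polar {μ = μ} {y = y}) ≤-refl

    -- Only one inequality has to be checked, as every presheaf lies below its
    -- closure.
    closed : {q : Q₀} (μ : Presheaf 𝔸 q) →
             ({p : Q₀} (x : 𝔸.Obj p) → (φ ↓ φ ↑ μ) [ x ] ≤ μ [ x ]) → Closed μ
    closed μ h x refl = Hom.antisym (h x)
      (from (≤-↓ {κ = φ ↑ μ} {x = x}) (λ y → polar-∘ μ y x))

    ↓-closed : {q : Q₀} (κ : Copresheaf 𝔹 q) → Closed (φ ↓ κ)
    ↓-closed κ = closed (φ ↓ κ) λ x → from (≤-↓ {κ = κ} {x = x}) λ y → ≤-trans
      (∘-monoˡ _ (from (≤-polar {μ = φ ↓ κ} {y = y})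
        (λ x′ → to (≤-↓ {κ = κ} {x = x′}) ≤-refl y)))
      (to (≤-↓ {κ = φ ↑ (φ ↓ κ)} {x = x}) ≤-refl y)

    ≤-closed : {p q : Q₀} {μ : Presheaf 𝔸 q} → Closed μ → {x : 𝔸.Obj p} {w : Arr p q} →
               ({r : Q₀} (y : 𝔹.Obj r) → polar μ y ∘ w ≤ φ.at x y) → w ≤ μ [ x ]
    ≤-closed {μ = μ} c {x} h = ≤-trans (from (≤-↓ {κ = φ ↑ μ} {x = x}) h) (≈⇒≤ (c x refl))

    𝖬-separated : Separated (𝖬 φ)
    𝖬-separated (μ , _) (ν , _) (μ⊑ν , ν⊑μ) x refl = Hom.antisym
      (≤-trans 1∘-≥ (to (≤-𝖯-hom {μ = μ} {ν = ν}) μ⊑ν x))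
      (≤-trans 1∘-≥ (to (≤-𝖯-hom {μ = ν} {ν = μ}) ν⊑μ x))

    -- F (a , u) is the closure of u ∘ 𝔸(-,a), presented as the polar of the
    -- copresheaf φ(a,-) ↙ u = φ ↑ (u ∘ 𝔸(-,a)).
    generator : {p q : Q₀} → 𝔸.Obj p → Arr p q → 𝖬φ.Obj q
    generator a u = φ ↓ κ , ↓-closed κ
      where
      κ : Copresheaf 𝔹 _
      κ = copresheaf (λ y → φ.at a y ↙ u) λ y y′ → ↙-intro
        (≤-trans assoc-≤ (≤-trans (∘-monoʳ _ ↙-eval) (φ.actˡ a y y′)))

    -- G (b , v) is the presheaf v ↘ φ(-,b).
    cogenerator : {p q : Q₀} → 𝔹.Obj p → Arr q p → 𝖬φ.Obj q
    cogenerator b v = γ , closed γ λ x → ↘-intro (≤-trans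
        (∘-monoˡ _ (from (≤-polar {μ = γ} {y = b}) (λ _ → ↘-eval)))
        (to (≤-↓ {κ = φ ↑ γ} {x = x}) ≤-refl b))
      where
      γ : Presheaf 𝔸 _
      γ = presheaf (λ x → v ↘ φ.at x b) λ x x′ → ↘-intro
        (≤-trans assoc-≥ (≤-trans (∘-monoˡ _ ↘-eval) (φ.actʳ x x′ b)))

    generator-hom : {p q r : Q₀} (a : 𝔸.Obj p) (u : Arr p q) (ν : 𝖬φ.Obj r) →
                    𝖬φ.hom (generator a u) ν ≈ proj₁ ν [ a ] ↙ u
    generator-hom a u (ν , ν-closed) = Hom.antisym
      (↙-intro (≤-trans (∘-monoʳ _ unit) (to (≤-𝖯-hom {μ = F} {ν = ν}) ≤-refl a)))
      (from (≤-𝖯-hom {μ = F} {ν = ν}) λ x → ≤-closed {μ = ν} ν-closed λ y →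
        ≤-trans assoc-≥ (≤-trans
          (∘-monoˡ _ (↙-intro (≤-trans assoc-≤ (≤-trans (∘-monoʳ _ ↙-eval) (polar-∘ ν y a)))))
          (↘-elim (Hom.⋀-lower _ (_ , y)))))
      where
      F : Presheaf 𝔸 _
      F = proj₁ (generator a u)

      unit : u ≤ F [ a ]
      unit = Hom.⋀-greatest _ _ λ { (_ , y) → ↘-intro ↙-eval }

    cogenerator-hom : {p q r : Q₀} (b : 𝔹.Obj p) (v : Arr q p) (ν : 𝖬φ.Obj r) →
                      𝖬φ.hom ν (cogenerator b v) ≈ v ↘ polar (proj₁ ν) b
    cogenerator-hom b v (ν , _) = Hom.antisym
      (↘-intro (from (≤-polar {μ = ν} {y = b}) λ x →
        ≤-trans assoc-≤ (↘-elim (to (≤-𝖯-hom {μ = ν} {ν = G}) ≤-refl x))))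
      (from (≤-𝖯-hom {μ = ν} {ν = G}) λ x → ↘-intro
        (≤-trans assoc-≥ (≤-trans (∘-monoˡ _ ↘-eval) (polar-∘ ν b x))))
      where
      G : Presheaf 𝔸 _
      G = proj₁ (cogenerator b v)

    generator-⊑ : {p q : Q₀} {a : 𝔸.Obj p} {u : Arr p q} {ν : 𝖬φ.Obj q} →
                  (generator a u 𝖬φ.⊑ ν) ⇔ (u ≤ proj₁ ν [ a ])
    generator-⊑ {a = a} {u} {ν} = mk⇔
      (λ h → ≤-trans 1∘-≥ (↙-elim (≤-trans h (≈⇒≤ (generator-hom a u ν)))))
      (λ h → ≤-trans (↙-intro (≤-trans 1∘-≤ h)) (≈⇒≥ (generator-hom a u ν)))

    ⊑-cogenerator : {p q : Q₀} {b : 𝔹.Obj p} {v : Arr q p} {ν : 𝖬φ.Obj q} →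
                    (ν 𝖬φ.⊑ cogenerator b v) ⇔ (v ≤ polar (proj₁ ν) b)
    ⊑-cogenerator {b = b} {v} {ν} = mk⇔
      (λ h → ≤-trans ∘1-≥ (↘-elim (≤-trans h (≈⇒≤ (cogenerator-hom b v ν)))))
      (λ h → ≤-trans (↘-intro (≤-trans ∘1-≤ h)) (≈⇒≥ (cogenerator-hom b v ν)))

    hom-generator-cogenerator :
      {p q r s : Q₀} (a : 𝔸.Obj p) (u : Arr p q) (b : 𝔹.Obj r) (v : Arr s r) →
      v ↘ (φ.at a b ↙ u) ≈ 𝖬φ.hom (generator a u) (cogenerator b v)
    hom-generator-cogenerator a u b v = Hom.Eq.trans (↘-↙-comm v (φ.at a b) u)
      (Hom.Eq.sym (generator-hom a u (cogenerator b v)))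

    -- The map F for 𝕏 = 𝖬 φ.
    generators : TypedMap Q (𝔸 ×dom) 𝖬φ.objects
    generators = record
      { map  = λ { (_ , a , u) → generator a u }
      ; cong = λ { (eq {a = a} {a′} {u} {u′} a≋ u≈) →
          𝖬-separated (generator a u) (generator a′ u′)
          ( mono (𝔸.≋⇒⊑ a≋) (≈⇒≤ u≈) , mono (𝔸.≋⇒⊑ (𝔸.≋-sym a≋)) (≈⇒≥ u≈) ) }
      }
      where
      mono : {p q : Q₀} {a a′ : 𝔸.Obj p} {u u′ : Arr p q} → a 𝔸.⊑ a′ → u ≤ u′ →
             generator a u 𝖬φ.⊑ generator a′ u′
      mono {a = a} {a′} {u} {u′} a⊑ u≤ = from (generator-⊑ {a = a} {ν = F′})
        (≤-trans u≤ (≤-trans (to (generator-⊑ {a = a′} {ν = F′}) (𝖬φ.hom-id F′))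
          (≤-trans ∘1-≥ (≤-trans (∘-monoʳ _ a⊑) (Distributor.actʳ (proj₁ F′) a′ a refl)))))
        where
        F′ : 𝖬φ.Obj _
        F′ = generator a′ u′

    -- The map G for 𝕏 = 𝖬 φ.
    cogenerators : TypedMap Q (𝔹 ×cod) 𝖬φ.objects
    cogenerators = record
      { map  = λ { (_ , b , v) → cogenerator b v }
      ; cong = λ { (eq {b = b} {b′} {v} {v′} b≋ v≈) →
          𝖬-separated (cogenerator b v) (cogenerator b′ v′)
          ( mono (𝔹.≋⇒⊑ b≋) (≈⇒≥ v≈) , mono (𝔹.≋⇒⊑ (𝔹.≋-sym b≋)) (≈⇒≤ v≈) ) }
      }
      where
      mono : {p q : Q₀} {b b′ : 𝔹.Obj p} {v v′ : Arr q p} → b 𝔹.⊑ b′ → v′ ≤ v →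
             cogenerator b v 𝖬φ.⊑ cogenerator b′ v′
      mono {b = b} {b′} {v} {v′} b⊑ v≤ = from (⊑-cogenerator {b = b′} {ν = G})
        (≤-trans v≤ (≤-trans (to (⊑-cogenerator {b = b} {ν = G}) (𝖬φ.hom-id G))
          (≤-trans 1∘-≥ (≤-trans (∘-monoˡ _ b⊑) (Distributor.actˡ (φ ↑ proj₁ G) refl b b′)))))
        where
        G : 𝖬φ.Obj _
        G = cogenerator b v

    -- The closed presheaf ν is the join of all F (a , ν(a)).
    generators-dense : ⋁-Dense (𝖬 φ) generators
    generators-dense {q} ν = Σ Q₀ 𝔸.Obj , (λ (p , a) → p , a , proj₁ ν [ a ]) ,
      (λ (_ , a) → from (generator-⊑ {a = a} {ν = ν}) ≤-refl) ,
      λ ζ h → from (≤-𝖯-hom {μ = proj₁ ν} {ν = proj₁ ζ}) λ a →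
        ≤-trans 1∘-≤ (to (generator-⊑ {a = a} {ν = ζ}) (h (_ , a)))

    -- The closed presheaf ν is the meet of all G (b , (φ ↑ ν)(b)).
    cogenerators-dense : ⋀-Dense (𝖬 φ) cogenerators
    cogenerators-dense {q} ν@(ν₀ , ν-closed) =
      Σ Q₀ 𝔹.Obj , (λ (p , b) → p , b , polar ν₀ b) ,
      (λ (_ , b) → from (⊑-cogenerator {b = b} {ν = ν}) ≤-refl) ,
      λ { ζ@(ζ₀ , _) h → from (≤-𝖯-hom {μ = ζ₀} {ν = ν₀}) λ x →
        ≤-trans 1∘-≤ (≤-closed {μ = ν₀} ν-closed λ b → ≤-trans
          (∘-monoˡ _ (to (⊑-cogenerator {b = b} {ν = ζ}) (h (_ , b))))
          (polar-∘ ζ₀ b x)) }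

-- Representing a complete category by closed presheaves

  module Representation
    {𝔸 𝔹 : QCategory Q} (φ : Distributor 𝔸 𝔹) (𝕏 : QCategory Q)
    (separated : Separated 𝕏) (complete : Complete 𝕏)
    (F : TypedMap Q (𝔸 ×dom) (QCategory.objects 𝕏))
    (G : TypedMap Q (𝔹 ×cod) (QCategory.objects 𝕏))
    (F-dense : ⋁-Dense 𝕏 F) (G-dense : ⋀-Dense 𝕏 G)
    (hom-FG : {p q r s : Q₀} (a : QCategory.Obj 𝔸 p) (u : Arr p q)
              (b : QCategory.Obj 𝔹 r) (v : Arr s r) →
              v ↘ (Distributor.at φ a b ↙ u)
                ≈ QCategory.hom 𝕏 (TypedMap.map F (p , a , u)) (TypedMap.map G (r , b , v)))
    where
    private
      module 𝔸 = QCategoryProperties 𝔸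
      module 𝔹 = QCategoryProperties 𝔹
      module φ = Distributor φ
    open QCategoryProperties 𝕏
    open CompleteProperties complete
    open ClosedPresheaves φ

    F′ : {p q : Q₀} → 𝔸.Obj p → Arr p q → Obj q
    F′ a u = TypedMap.map F (_ , a , u)

    G′ : {p q : Q₀} → 𝔹.Obj p → Arr q p → Obj q
    G′ b v = TypedMap.map G (_ , b , v)

    -- F (a , 1) and G (b , 1), the images of the objects of 𝔸 and 𝔹 themselves.
    F₁ : {p : Q₀} → 𝔸.Obj p → Obj p
    F₁ a = F′ a (1ₐ _)

    G₁ : {p : Q₀} → 𝔹.Obj p → Obj p
    G₁ b = G′ b (1ₐ _)

    ≤-hom-FG : {p q r s : Q₀} {a : 𝔸.Obj p} {u : Arr p q} {b : 𝔹.Obj r} {v : Arr s r}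
               {w : Arr q s} → (w ≤ hom (F′ a u) (G′ b v)) ⇔ (v ∘ (w ∘ u) ≤ φ.at a b)
    ≤-hom-FG {a = a} {u} {b} {v} = mk⇔
      (λ h → to ≤-↘-↙ (≤-trans h (≈⇒≥ (hom-FG a u b v))))
      (λ h → ≤-trans (from ≤-↘-↙ h) (≈⇒≤ (hom-FG a u b v)))

    φ≈hom : {p q : Q₀} (a : 𝔸.Obj p) (b : 𝔹.Obj q) → φ.at a b ≈ hom (F₁ a) (G₁ b)
    φ≈hom a b = Hom.antisym
      (from ≤-hom-FG (≤-trans 1∘-≤ ∘1-≤))
      (≤-trans ∘1-≥ (≤-trans 1∘-≥ (to ≤-hom-FG ≤-refl)))

    -- F (a , u) is the tensor of F (a , 1) by u: write y as a meet of
    -- objects G (b , v) and compare.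
    ≤-hom-F : {p q r : Q₀} {a : 𝔸.Obj p} {u : Arr p q} {y : Obj r} {w : Arr q r} →
              (w ≤ hom (F′ a u) y) ⇔ (w ∘ u ≤ hom (F₁ a) y)
    ≤-hom-F {y = y} with G-dense y
    ... | J , g , meet@(lower , _) = mk⇔
      (λ h → meet-hom meet λ j → from ≤-hom-FG (≤-trans (∘-monoʳ _ ∘1-≤)
        (to ≤-hom-FG (≤-trans 1∘-≥ (∘-⊑ (lower j) h)))))
      (λ h → meet-hom meet λ j → from ≤-hom-FG (≤-trans (∘-monoʳ _ ∘1-≥)
        (to ≤-hom-FG (≤-trans 1∘-≥ (∘-⊑ (lower j) h)))))

    -- G (b , v) is the cotensor of G (b , 1) by v.
    ≤-hom-G : {p q r : Q₀} {x : Obj r} {b : 𝔹.Obj p} {v : Arr q p} {w : Arr r q} →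
              (w ≤ hom x (G′ b v)) ⇔ (v ∘ w ≤ hom x (G₁ b))
    ≤-hom-G {x = x} with F-dense x
    ... | I , f , join@(upper , _) = mk⇔
      (λ h → join-hom join λ i → from ≤-hom-FG (≤-trans 1∘-≤ (≤-trans assoc-≤
        (to ≤-hom-FG (≤-trans ∘1-≥ (∘-⊑ h (upper i)))))))
      (λ h → join-hom join λ i → from ≤-hom-FG (≤-trans assoc-≥ (≤-trans 1∘-≥
        (to ≤-hom-FG (≤-trans ∘1-≥ (∘-⊑ h (upper i)))))))

    -- 𝕏(x,y) is the meet of all 𝕏(F (a , 1),y) ↙ 𝕏(F (a , 1),x).  If x is a
    -- join of objects F (a , u), then u ≤ 𝕏(F (a , 1),x) for each of them.
    reflect-F : {q r : Q₀} {x : Obj q} {y : Obj r} {w : Arr q r} →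
                ({p : Q₀} (a : 𝔸.Obj p) → w ∘ hom (F₁ a) x ≤ hom (F₁ a) y) → w ≤ hom x y
    reflect-F {x = x} h with F-dense x
    ... | I , f , join@(upper , _) = join-hom join λ i → from ≤-hom-F
          (≤-trans (∘-monoʳ _ (≤-trans 1∘-≥ (to ≤-hom-F (upper i)))) (h _))

    -- 𝕏(x,y) is the meet of all 𝕏(y,G (b , 1)) ↘ 𝕏(x,G (b , 1)).
    reflect-G : {q r : Q₀} {x : Obj q} {y : Obj r} {w : Arr q r} →
                ({p : Q₀} (b : 𝔹.Obj p) → hom y (G₁ b) ∘ w ≤ hom x (G₁ b)) → w ≤ hom x y
    reflect-G {y = y} h with G-dense y
    ... | J , g , meet@(lower , _) = meet-hom meet λ j → from ≤-hom-G
          (≤-trans (∘-monoˡ _ (≤-trans ∘1-≥ (to ≤-hom-G (lower j)))) (h _))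

    F₁-hom : {p p′ : Q₀} (a : 𝔸.Obj p) (a′ : 𝔸.Obj p′) → 𝔸.hom a a′ ≤ hom (F₁ a) (F₁ a′)
    F₁-hom a a′ = reflect-G λ b → ≤-trans (∘-monoˡ _ (≈⇒≥ (φ≈hom a′ b)))
      (≤-trans (φ.actʳ a′ a b) (≈⇒≤ (φ≈hom a b)))

    -- The presheaf 𝕏(F-,x) on 𝔸, with a ∈ 𝔸 sent to F (a , 1).
    restrict : {q : Q₀} → Obj q → Presheaf 𝔸 q
    restrict x = presheaf (λ a → hom (F₁ a) x) λ a a′ → ∘-⊑ ≤-refl (F₁-hom a′ a)

    -- A presheaf μ with φ ↑ μ = 𝕏(x,G-) has closure 𝕏(F-,x).
    ↓-restrict : {q : Q₀} {x : Obj q} (μ : Presheaf 𝔸 q) →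
                 ({r : Q₀} (b : 𝔹.Obj r) → polar μ b ≈ hom x (G₁ b)) → φ ↓ φ ↑ μ ≈ᵈ restrict x
    ↓-restrict μ e a refl = Hom.antisym
      (reflect-G λ b → ≤-trans (∘-monoˡ _ (≈⇒≥ (e b)))
        (≤-trans (to (≤-↓ {κ = φ ↑ μ} {x = a}) ≤-refl b) (≈⇒≤ (φ≈hom a b))))
      (from (≤-↓ {κ = φ ↑ μ} {x = a}) λ b → ≤-trans
        (∘-⊑ (≈⇒≤ (e b)) ≤-refl) (≈⇒≥ (φ≈hom a b)))

    ↑-restrict : {q r : Q₀} (x : Obj q) (b : 𝔹.Obj r) → polar (restrict x) b ≈ hom x (G₁ b)
    ↑-restrict x b = Hom.antisym
      (reflect-F λ a → ≤-trans (polar-∘ (restrict x) b a) (≈⇒≤ (φ≈hom a b)))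
      (from (≤-polar {μ = restrict x} {y = b}) λ a → ≤-trans
        (hom-comp _ _ _) (≈⇒≥ (φ≈hom a b)))

    -- The functor x ↦ 𝕏(F-,x).
    representation : QFunctor 𝕏 (𝖬 φ)
    representation = record
      { typedMap = record
          { map  = λ x → restrict x , ↓-restrict (restrict x) (↑-restrict x)
          ; cong = λ { x≋y a refl → hom-cong ≋-refl x≋y }
          }
      ; hom-≤    = λ x y → from (≤-𝖯-hom {μ = restrict x} {ν = restrict y}) λ a → hom-comp _ _ _
      }

    -- The colimit of F weighted by the closed presheaf μ is mapped to μ.
    representation-surjective : {q : Q₀} (μ : QCategory.Obj (𝖬 φ) q) →
      Σ[ s ∈ Obj q ] (restrict s ≈ᵈ proj₁ μ)
    representation-surjective (μ , μ-closed)
      with weightedSup {I = Σ Q₀ 𝔸.Obj} (λ (_ , a) → F₁ a) (λ (_ , a) → μ [ a ])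
    ... | s , s-hom = s , λ { a refl → Hom.Eq.trans
          (Hom.Eq.sym (↓-restrict μ ↑-s a refl)) (μ-closed a refl) }
      where
      ↑-s : {r : Q₀} (b : 𝔹.Obj r) → polar μ b ≈ hom s (G₁ b)
      ↑-s b = Hom.antisym
        (from s-hom λ (_ , a) → ≤-trans (polar-∘ μ b a) (≈⇒≤ (φ≈hom a b)))
        (from (≤-polar {μ = μ} {y = b}) λ a → ≤-trans
          (to s-hom ≤-refl (_ , a)) (≈⇒≥ (φ≈hom a b)))

    𝕏-isomorphic-𝖬 : Isomorphic 𝕏 (𝖬 φ)
    𝕏-isomorphic-𝖬 = fullyFaithful∧surjective⇒isomorphic separated representation
      (λ x y → reflect-F λ a → to (≤-𝖯-hom {μ = restrict x} {ν = restrict y}) ≤-refl a)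
      representation-surjective

theorem7p7 :
  {ℓ : Level} (Q : Quantaloid ℓ) →
  let open Quantaloid Q in
  (𝔸 𝔹 : QCategory Q) (φ : Distributor 𝔸 𝔹)
  (𝕏 : QCategory Q) → Separated 𝕏 → Complete 𝕏 →
  let module 𝔸 = QCategory 𝔸
      module 𝔹 = QCategory 𝔹
      module 𝕏 = QCategory 𝕏
  in
  Isomorphic 𝕏 (𝖬 φ)
    ⇔
  (Σ[ F ∈ TypedMap Q (𝔸 ×dom) 𝕏.objects ]
   Σ[ G ∈ TypedMap Q (𝔹 ×cod) 𝕏.objects ]
     ⋁-Dense 𝕏 F × ⋀-Dense 𝕏 G ×
     ({p q r s : Q₀} (a : 𝔸.Obj p) (u : Arr p q) (b : 𝔹.Obj r) (v : Arr s r) →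
      v ↘ (Distributor.at φ a b ↙ u)
        ≈ 𝕏.hom (TypedMap.map F (p , a , u)) (TypedMap.map G (r , b , v))))
theorem7p7 Q 𝔸 𝔹 φ 𝕏 separated complete = mk⇔
  (λ iso →
    let U = QFunctor.typedMap (Isomorphic.from iso) in
    U ∘ᵗ generators , U ∘ᵗ cogenerators ,
    (λ {_} → isomorphic-⋁-Dense iso generators generators-dense) ,
    (λ {_} → isomorphic-⋀-Dense iso cogenerators cogenerators-dense) ,
    λ {_} {_} {_} {_} a u b v → Quantaloid.Hom.Eq.trans Q (hom-generator-cogenerator a u b v)
      (isomorphic-hom iso (generator a u) (cogenerator b v)))
  (λ { (F , G , F-dense , G-dense , hom-FG) →
    Representation.𝕏-isomorphic-𝖬 φ 𝕏 separated complete F G F-dense G-dense hom-FG })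
  where open ClosedPresheaves φ
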